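{- Let $n\ge 5$ and let $S_n^3 = K_n\vee\overline{K_3}$ be the complete split graph. Then the all-negative signature maximises the frustration index of $S_n^3$ uniquely, and \[ l_{\max}(S_n^3) = l(-S_n^3) = \left\lfloor \frac{(n-1)^2}{4} + \frac{3n}{2} - \frac{9}{4}\right\rfloor . \]
   Context: All graphs are finite, simple and undirected. A signed graph $\Sigma=(G,\sigma)$ is a graph $G$ with a signature $\sigma:E(G)\to\{+1,-1\}$. The sign of a cycle is the product of the signs of its edges; $\Sigma$ is balanced if all its cycles are positive. The frustration index $l(\Sigma)$ is the minimum number of edges whose deletion makes $\Sigma$ balanced. $-G$ is $G$ with all edges signed $-1$. $l_{\max}(G)=\max_\sigma l(G,\sigma)$. Switching $\Sigma$ at a vertex subset $X$ negates the signs of all edges with exactly one endpoint in $X$; two signatures are switching equivalent if one is obtained from the other by switching. The all-negative signature maximises the frustration index of $G$ uniquely if $l(-G)=l_{\max}(G)$ and every $\sigma$ with $l(G,\sigma)=l_{\max}(G)$ is switching equivalent to the all-negative signature. $\overline{K_m}$ is the edgeless graph on $m$ vertices and $\vee$ denotes the join. -}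

module Defs where

open import Data.Bool.Base using (Bool; true; false; not; _∧_; _xor_; if_then_else_; T)
open import Data.Bool.Properties using (T-∧)
open import Data.Fin.Base using (Fin; toℕ; splitAt)
open import Data.Fin.Properties using (_≟_)
open import Data.Fin.Subset using (Subset)
open import Data.Integer.Base as ℤ using (ℤ)
open import Data.List.Base using (List; []; _∷_)
open import Data.List.Relation.Unary.Unique.Propositional using (Unique)
open import Data.Nat.Base using (ℕ; zero; suc; _+_; _≤_; _<ᵇ_)
open import Data.Nat.Properties using (+-0-commutativeMonoid)
open import Data.Product.Base using (Σ; ∃; _×_; _,_; proj₁)
open import Data.Rational.Unnormalised.Base as ℚᵘ using (ℚᵘ; floor)
open import Data.Sign.Base as Sign using (Sign; opposite)
open import Data.Sum.Base using (_⊎_; inj₁; inj₂)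
open import Data.Vec.Base using (lookup)
open import Function.Bundles using (Equivalence)
open import Relation.Binary.PropositionalEquality
  using (_≡_; refl; sym; cong; cong₂; ≢-sym)
open import Relation.Nullary.Decidable.Core using (does; yes; no)
open import Relation.Nullary.Negation.Core using (contradiction)

open import Algebra.Properties.CommutativeMonoid.Sum +-0-commutativeMonoid using (sum)

record Graph (n : ℕ) : Set where
  field
    adj        : Fin n → Fin n → Bool
    adj-sym    : ∀ u v → adj u v ≡ adj v u
    adj-irrefl : ∀ v → adj v v ≡ false

open Graph public

Adj : ∀ {n} → Graph n → Fin n → Fin n → Set
Adj G u v = T (adj G u v)

-- Each edge is counted once, at its orientation u < v.
edgeCount : ∀ {n} → Graph n → ℕ
edgeCount G = sum λ u → sum λ v →
  if (toℕ u <ᵇ toℕ v) ∧ adj G u v then 1 else 0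

private
  distinct : ∀ {n} → Fin n → Fin n → Bool
  distinct u v = not (does (u ≟ v))

  distinct-sym : ∀ {n} (u v : Fin n) → distinct u v ≡ distinct v u
  distinct-sym u v with u ≟ v | v ≟ u
  ... | yes _ | yes _ = refl
  ... | no _  | no _  = refl
  ... | yes p | no ¬q = contradiction (sym p) ¬q
  ... | no ¬p | yes q = contradiction (sym q) ¬p

  distinct-irrefl : ∀ {n} (v : Fin n) → distinct v v ≡ false
  distinct-irrefl v with v ≟ v
  ... | yes _ = refl
  ... | no ¬p = contradiction refl ¬p

complete : ∀ n → Graph n
complete n = record
  { adj        = distinct
  ; adj-sym    = distinct-sym
  ; adj-irrefl = distinct-irrefl
  }

edgeless : ∀ n → Graph n
edgeless n = record
  { adj        = λ _ _ → false
  ; adj-sym    = λ _ _ → refl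
  ; adj-irrefl = λ _ → refl
  }

module _ {m n} (G : Graph m) (H : Graph n) where

  joinAdj : Fin m ⊎ Fin n → Fin m ⊎ Fin n → Bool
  joinAdj (inj₁ u) (inj₁ v) = adj G u v
  joinAdj (inj₁ _) (inj₂ _) = true
  joinAdj (inj₂ _) (inj₁ _) = true
  joinAdj (inj₂ u) (inj₂ v) = adj H u v

  private
    joinAdj-sym : ∀ x y → joinAdj x y ≡ joinAdj y x
    joinAdj-sym (inj₁ u) (inj₁ v) = adj-sym G u v
    joinAdj-sym (inj₁ _) (inj₂ _) = refl
    joinAdj-sym (inj₂ _) (inj₁ _) = refl
    joinAdj-sym (inj₂ u) (inj₂ v) = adj-sym H u v

    joinAdj-irrefl : ∀ x → joinAdj x x ≡ false
    joinAdj-irrefl (inj₁ v) = adj-irrefl G v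
    joinAdj-irrefl (inj₂ v) = adj-irrefl H v

  infixr 6 _∨ᴳ_

  _∨ᴳ_ : Graph (m + n)
  _∨ᴳ_ = record
    { adj        = λ u v → joinAdj (splitAt m u) (splitAt m v)
    ; adj-sym    = λ u v → joinAdj-sym (splitAt m u) (splitAt m v)
    ; adj-irrefl = λ v → joinAdj-irrefl (splitAt m v)
    }

-- S m n is the complete split graph written S_n^m, with an n-clique and an
-- independent set of size m.
S : (m n : ℕ) → Graph (n + m)
S m n = complete n ∨ᴳ edgeless m

-- A map E(G) → {+1,-1}. Adj G u v is a proposition, so a signature assigns
-- exactly one sign to each unordered edge.
record Signature {n} (G : Graph n) : Set where
  field
    sign     : ∀ u v → Adj G u v → Sign
    sign-sym : ∀ u v (e : Adj G u v) (e′ : Adj G v u) → sign u v e ≡ sign v u e′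

open Signature public

allNegative : ∀ {n} (G : Graph n) → Signature G
allNegative G = record { sign = λ _ _ _ → Sign.- ; sign-sym = λ _ _ _ _ → refl }

private
  xor-comm : ∀ x y → x xor y ≡ y xor x
  xor-comm false false = refl
  xor-comm false true  = refl
  xor-comm true  false = refl
  xor-comm true  true  = refl

switch : ∀ {n} {G : Graph n} → Subset n → Signature G → Signature G
switch X σ = record
  { sign     = λ u v e → flipIf (lookup X u xor lookup X v) (sign σ u v e)
  ; sign-sym = λ u v e e′ →
      cong₂ flipIf (xor-comm (lookup X u) (lookup X v)) (sign-sym σ u v e e′)
  }
  where
  flipIf : Bool → Sign → Sign
  flipIf b s = if b then opposite s else s

SwitchingEquivalent : ∀ {n} {G : Graph n} → Signature G → Signature G → Set
SwitchingEquivalent {n} {G} σ τ =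
  Σ (Subset n) λ X → ∀ u v (e : Adj G u v) → sign τ u v e ≡ sign (switch X σ) u v e

data Walk {n} (G : Graph n) : Fin n → Fin n → Set where
  []  : ∀ {v} → Walk G v v
  _∷_ : ∀ {u v w} → Adj G u v → Walk G v w → Walk G u w

length : ∀ {n} {G : Graph n} {u v} → Walk G u v → ℕ
length []      = 0
length (_ ∷ w) = suc (length w)

-- The vertices visited, without the final one: a closed walk lists its base
-- point only once.
initialVertices : ∀ {n} {G : Graph n} {u v} → Walk G u v → List (Fin n)
initialVertices []            = []
initialVertices (_∷_ {u} _ w) = u ∷ initialVertices w

IsCycle : ∀ {n} {G : Graph n} {v} → Walk G v v → Set
IsCycle w = 3 ≤ length w × Unique (initialVertices w)

walkSign : ∀ {n} {G : Graph n} → Signature G → ∀ {u v} → Walk G u v → Sign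
walkSign σ []                = Sign.+
walkSign σ (_∷_ {u} {v} e w) = sign σ u v e Sign.* walkSign σ w

Balanced : ∀ {n} {G : Graph n} → Signature G → Set
Balanced {G = G} σ = ∀ {v} (w : Walk G v v) → IsCycle w → walkSign σ w ≡ Sign.+

-- A set of edges of G is given by the spanning subgraph with those edges.
_⊆ᴱ_ : ∀ {n} → Graph n → Graph n → Set
F ⊆ᴱ G = ∀ u v → Adj F u v → Adj G u v

_∖_ : ∀ {n} → Graph n → Graph n → Graph n
G ∖ F = record
  { adj        = λ u v → adj G u v ∧ not (adj F u v)
  ; adj-sym    = λ u v → cong₂ (λ a b → a ∧ not b) (adj-sym G u v) (adj-sym F u v)
  ; adj-irrefl = λ v → cong (_∧ not (adj F v v)) (adj-irrefl G v)
  }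

deleteEdges : ∀ {n} {G : Graph n} → Signature G → (F : Graph n) → Signature (G ∖ F)
deleteEdges {G = G} σ F = record
  { sign     = λ u v e → sign σ u v (inG e)
  ; sign-sym = λ u v e e′ → sign-sym σ u v (inG e) (inG e′)
  }
  where
  inG : ∀ {u v} → Adj (G ∖ F) u v → Adj G u v
  inG e = proj₁ (Equivalence.to T-∧ e)

-- The minimum l(G, σ) and the maximum l_max(G) range over nonempty finite sets,
-- so they exist; both are given as relations: FrustrationIndex σ k reads
-- l(G, σ) = k, and MaxFrustrationIndex G k reads l_max(G) = k.
FrustrationIndex : ∀ {n} {G : Graph n} → Signature G → ℕ → Set
FrustrationIndex {n} {G} σ k =
    (Σ (Graph n) λ F → F ⊆ᴱ G × Balanced (deleteEdges σ F) × edgeCount F ≡ k)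
  × (∀ F → F ⊆ᴱ G → Balanced (deleteEdges σ F) → k ≤ edgeCount F)

MaxFrustrationIndex : ∀ {n} → Graph n → ℕ → Set
MaxFrustrationIndex G k =
    (Σ (Signature G) λ σ → FrustrationIndex σ k)
  × (∀ (σ : Signature G) l → FrustrationIndex σ l → l ≤ k)

AllNegativeMaximisesUniquely : ∀ {n} → Graph n → Set
AllNegativeMaximisesUniquely G = ∃ λ k →
    FrustrationIndex (allNegative G) k
  × MaxFrustrationIndex G k
  × (∀ (σ : Signature G) → FrustrationIndex σ k → SwitchingEquivalent σ (allNegative G))

splitFormula : ℕ → ℤ
splitFormula n = floor
  (((ℤ.+ n ℤ.- ℤ.+ 1) ℤ.^ 2) ℚᵘ./ 4 ℚᵘ.+ (ℤ.+ 3 ℤ.* ℤ.+ n) ℚᵘ./ 2 ℚᵘ.- ℤ.+ 9 ℚᵘ./ 4)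

{-# OPTIONS --safe #-}
module Submission where

-- Lower bound for -G, G = S_n^3: if deleting F leaves only positive cycles, then
-- G ∖ F is triangle-free and Mantel's theorem on n + 3 vertices bounds its size.
--
-- Upper bound: switch σ so that all edges at one clique vertex are negative, and
-- induct on n. A switching of G - v extends to G at the cost of at most half the
-- degree of v, which for a clique vertex v is exactly the increment of the claimed
-- maximum; so if G - v is beaten strictly for some v, so is G. Otherwise, each edge
-- being missed by one of three removed clique vertices, all edges are negative.
-- The case n = 5 is a finite search.

open import Defs
open import Data.Bool.Base using (Bool; true; false; not; _∧_; _xor_; if_then_else_; T)
open import Data.Bool.Properties using (T?; T-∧; xor-comm) renaming (_≟_ to _≟ᵇ_)
open import Data.Bool.Solver using (module xor-∧-Solver)
open import Data.Empty using (⊥-elim)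
open import Data.Fin.Base using (Fin; zero; suc; toℕ; punchIn; punchOut; splitAt; _↑ˡ_)
open import Data.Fin.Patterns using (0F; 1F; 2F; 3F; 4F; 5F; 6F; 7F)
open import Data.Fin.Properties using (_≟_; punchIn-injective; punchInᵢ≢i; punchIn-punchOut; splitAt-↑ˡ; toℕ-injective)
open import Data.Fin.Subset.Properties using (anySubset?)
open import Data.Integer.Base as ℤ using (+_; -[1+_])
open import Data.Integer.DivMod using (div-pos-is-/ℕ)
open import Data.List.Relation.Unary.All using ([]; _∷_)
open import Data.List.Relation.Unary.AllPairs using ([]; _∷_)
open import Data.Nat.Base using (ℕ; zero; suc; _+_; _*_; _≤_; _<_; _<ᵇ_; _⊓_; _/_; z≤n; s≤s; ⌊_/2⌋; ⌈_/2⌉)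
open import Data.Nat.DivMod using (+-distrib-/-∣ʳ; m*n/n≡m; m<n⇒m/n≡0)
open import Data.Nat.Divisibility using (n∣m*n)
open import Data.Nat.Properties hiding (_≟_)
open import Data.Nat.Tactic.RingSolver using (solve-∀)
open import Data.Product.Base using (∃; _×_; _,_; proj₁; proj₂; map₂; uncurry)
open import Data.Sign.Base as Sign using (Sign; opposite)
open import Data.Sum.Base using (_⊎_; inj₁; inj₂; map₁; [_,_]′) renaming (map to map-⊎)
open import Data.Vec.Base using (Vec; []; _∷_; lookup; replicate; tabulate)
open import Data.Vec.Functional using (insertAt)
open import Data.Vec.Functional.Properties using (insertAt-lookup; insertAt-punchIn)
open import Data.Vec.Properties using (≡-dec; tabulate-cong; lookup∘tabulate; ∷-injectiveˡ; ∷-injectiveʳ)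
open import Function.Base using (_∘_)
open import Function.Bundles using (Equivalence)
open import Relation.Binary.Definitions using (tri<; tri≈; tri>)
open import Relation.Binary.PropositionalEquality
open import Relation.Nullary using (¬_; Dec; yes; no; contradiction)
open import Relation.Nullary.Decidable using (map′; _×-dec_; _⊎-dec_; from-yes)
open import Relation.Unary using (Decidable)

open import Algebra.Properties.CommutativeMonoid.Sum +-0-commutativeMonoid
  using (sum; sum-cong-≗; sum-remove; ∑-distrib-+; ∑-comm)

-- Edge counts, degrees and the removal of a vertex.

bit : Bool → ℕ
bit b = if b then 1 else 0

degree : ∀ {n} → Graph n → Fin n → ℕ
degree G u = sum λ v → bit (adj G u v)

infix 4 _≈_
_≈_ : ∀ {n} → Graph n → Graph n → Set
G ≈ H = ∀ u v → adj G u v ≡ adj H u v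

sum-mono : ∀ {n} {f g : Fin n → ℕ} → (∀ i → f i ≤ g i) → sum f ≤ sum g
sum-mono {zero}  h = z≤n
sum-mono {suc n} h = +-mono-≤ (h zero) (sum-mono (h ∘ suc))

sum-const : ∀ n c → sum {n} (λ _ → c) ≡ n * c
sum-const zero    c = refl
sum-const (suc n) c = cong (_+_ c) (sum-const n c)

sum-*ˡ : ∀ {n} c (f : Fin n → ℕ) → sum (λ i → c * f i) ≡ c * sum f
sum-*ˡ {zero}  c f = sym (*-zeroʳ c)
sum-*ˡ {suc n} c f = trans (cong (_+_ (c * f zero)) (sum-*ˡ c (f ∘ suc)))
  (sym (*-distribˡ-+ c (f zero) _))

sum-zip : ∀ {n} {f g h : Fin n → ℕ} → (∀ i → f i ≡ g i + h i) → sum f ≡ sum g + sum h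
sum-zip {g = g} {h} eq = trans (sum-cong-≗ eq) (∑-distrib-+ g h)

edgeCount-cong : ∀ {n} (G H : Graph n) → G ≈ H → edgeCount G ≡ edgeCount H
edgeCount-cong G H eq = sum-cong-≗ λ u → sum-cong-≗ λ v →
  cong (λ b → bit ((toℕ u <ᵇ toℕ v) ∧ b)) (eq u v)

-- Exactly one of the two comparisons holds unless `a ≡ b`, and in that case the hypothesis makes
-- `c` false.
<ᵇ-total : ∀ a b c → (a ≡ b → c ≡ false) →
           bit c ≡ bit ((a <ᵇ b) ∧ c) + bit ((b <ᵇ a) ∧ c)
<ᵇ-total zero    zero    c h rewrite h refl = refl
<ᵇ-total zero    (suc b) c h = sym (+-identityʳ _)
<ᵇ-total (suc a) zero    c h = refl
<ᵇ-total (suc a) (suc b) c h = <ᵇ-total a b c (h ∘ cong suc)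

handshake : ∀ {n} (G : Graph n) → sum (degree G) ≡ edgeCount G + edgeCount G
handshake {n} G = begin
  sum (degree G)                     ≡⟨ sum-zip (λ u → sum-zip (split u)) ⟩
  edgeCount G + sum (λ u → sum λ v → up v u) ≡⟨ cong (_+_ (edgeCount G)) (∑-comm (λ u v → up v u)) ⟩
  edgeCount G + edgeCount G          ∎
  where
  open ≡-Reasoning
  up : Fin n → Fin n → ℕ
  up u v = bit ((toℕ u <ᵇ toℕ v) ∧ adj G u v)

  split : ∀ u v → bit (adj G u v) ≡ up u v + up v u
  split u v = trans
    (<ᵇ-total (toℕ u) (toℕ v) (adj G u v) λ eq →
      trans (cong (adj G u) (sym (toℕ-injective eq))) (adj-irrefl G u))
    (cong (λ b → up u v + bit ((toℕ v <ᵇ toℕ u) ∧ b)) (adj-sym G u v))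

double-injective : ∀ {a b} → a + a ≡ b + b → a ≡ b
double-injective {a} {b} eq = begin
  a          ≡⟨ n≡⌊n+n/2⌋ a ⟩
  ⌊ a + a /2⌋ ≡⟨ cong ⌊_/2⌋ eq ⟩
  ⌊ b + b /2⌋ ≡⟨ sym (n≡⌊n+n/2⌋ b) ⟩
  b          ∎
  where open ≡-Reasoning

infixl 6 _-ᵛ_
_-ᵛ_ : ∀ {n} → Graph (suc n) → Fin (suc n) → Graph n
G -ᵛ i = record
  { adj        = λ u v → adj G (punchIn i u) (punchIn i v)
  ; adj-sym    = λ u v → adj-sym G (punchIn i u) (punchIn i v)
  ; adj-irrefl = λ v → adj-irrefl G (punchIn i v)
  }

degree-remove : ∀ {n} (G : Graph (suc n)) i →
                degree G i ≡ sum (λ u → bit (adj G i (punchIn i u)))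
degree-remove G i = trans (sum-remove {i = i} (λ v → bit (adj G i v)))
  (cong (λ b → bit b + sum (λ u → bit (adj G i (punchIn i u)))) (adj-irrefl G i))

-- Proved for the doubled count: degree sums treat both orientations of an edge alike, so `punchIn`
-- never has to be compared with the order that `edgeCount` uses.
edgeCount-remove : ∀ {n} (G : Graph (suc n)) i →
                   edgeCount G ≡ degree G i + edgeCount (G -ᵛ i)
edgeCount-remove {n} G i = double-injective (begin
  edgeCount G + edgeCount G
    ≡⟨ handshake G ⟨
  sum (degree G)
    ≡⟨ sum-remove {i = i} (degree G) ⟩
  d + sum (λ u → degree G (punchIn i u))
    ≡⟨ cong (_+_ d) (sum-zip λ u → sum-remove {i = i} (λ v → bit (adj G (punchIn i u) v))) ⟩
  d + (sum (λ u → bit (adj G (punchIn i u) i)) + sum (degree (G -ᵛ i)))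
    ≡⟨ cong₂ (λ x y → d + (x + y)) to-d (handshake (G -ᵛ i)) ⟩
  d + (d + (e + e))
    ≡⟨ rearrange d e ⟩
  (d + e) + (d + e) ∎)
  where
  open ≡-Reasoning
  d e : ℕ
  d = degree G i
  e = edgeCount (G -ᵛ i)
  to-d : sum (λ u → bit (adj G (punchIn i u) i)) ≡ d
  to-d = trans (sum-cong-≗ λ u → cong bit (adj-sym G (punchIn i u) i)) (sym (degree-remove G i))
  rearrange : ∀ d e → d + (d + (e + e)) ≡ (d + e) + (d + e)
  rearrange = solve-∀

-- Mantel's theorem.

TriangleFree : ∀ {n} → Graph n → Set
TriangleFree G = ∀ u v w → Adj G u v → Adj G v w → ¬ Adj G w u

argmax : ∀ {n} (f : Fin (suc n) → ℕ) → ∃ λ i → ∀ j → f j ≤ f i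
argmax {zero}  f = zero , λ { zero → ≤-refl }
argmax {suc n} f with argmax (f ∘ suc)
... | i , max with ≤-total (f zero) (f (suc i))
... | inj₁ le = suc i , λ { zero → le ; (suc j) → max j }
... | inj₂ ge = zero , λ { zero → ≤-refl ; (suc j) → ≤-trans (max j) ge }

-- The two sides differ by the square of the difference of `x` and `y`; the larger number is written
-- as the smaller plus `k` to avoid subtraction.
4xy≤[x+y]² : ∀ x y → 4 * (x * y) ≤ (x + y) * (x + y)
4xy≤[x+y]² x y with ≤-total x y
... | inj₁ x≤y with k , refl ← m≤n⇒∃[o]m+o≡n x≤y = subst (4 * (x * (x + k)) ≤_) (sym (eq x k)) (m≤m+n _ _)
  where
  eq : ∀ x k → (x + (x + k)) * (x + (x + k)) ≡ 4 * (x * (x + k)) + k * k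
  eq = solve-∀
... | inj₂ y≤x with k , refl ← m≤n⇒∃[o]m+o≡n y≤x = subst (4 * ((y + k) * y) ≤_) (sym (eq y k)) (m≤m+n _ _)
  where
  eq : ∀ x k → ((x + k) + x) * ((x + k) + x) ≡ 4 * ((x + k) * x) + k * k
  eq = solve-∀

-- The neighbourhood of a vertex x of maximum degree Δ is independent, so every
-- edge has an endpoint among the other m - Δ vertices, each of degree at most Δ.
mantel : ∀ {m} (G : Graph m) → TriangleFree G → 4 * edgeCount G ≤ m * m
mantel {zero}  G _    = z≤n
mantel {suc m} G free with argmax (degree G)
... | x , max = begin
  4 * edgeCount G                   ≤⟨ *-monoʳ-≤ 4 e≤ ⟩
  4 * (degree G x * sum outside)    ≤⟨ 4xy≤[x+y]² (degree G x) (sum outside) ⟩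
  (degree G x + sum outside) * (degree G x + sum outside)
                                    ≡⟨ cong₂ _*_ total total ⟩
  suc m * suc m                     ∎
  where
  open ≤-Reasoning
  outside : Fin (suc m) → ℕ
  outside u = bit (not (adj G x u))

  total : degree G x + sum outside ≡ suc m
  total = trans
    (sym (sum-zip {f = λ _ → 1} {g = λ u → bit (adj G x u)} {h = outside} λ u → lem (adj G x u)))
    (trans (sum-const (suc m) 1) (*-identityʳ (suc m)))
    where
    lem : ∀ b → 1 ≡ bit b + bit (not b)
    lem true  = refl
    lem false = refl

  -- Arcs that leave a non-neighbour of `x`. Every edge carries at least one of them, since an edge
  -- inside the neighbourhood of `x` would close a triangle.
  w : Fin (suc m) → Fin (suc m) → ℕ
  w u v = outside u * bit (adj G u v)

  arc≤ : ∀ u v → bit (adj G u v) ≤ w u v + w v u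
  arc≤ u v rewrite adj-sym G v u with adj G x u in xu | adj G x v in xv | adj G u v in uv
  ... | _     | _     | false = z≤n
  ... | false | _     | true  = s≤s z≤n
  ... | true  | false | true  = s≤s z≤n
  ... | true  | true  | true  = contradiction (subst T (sym (trans (adj-sym G v x) xv)) _)
    (free x u v (subst T (sym xu) _) (subst T (sym uv) _))

  s : ℕ
  s = sum λ u → sum (w u)

  2e≤ : edgeCount G + edgeCount G ≤ s + s
  2e≤ = begin
    edgeCount G + edgeCount G                 ≡⟨ handshake G ⟨
    sum (degree G)                            ≤⟨ sum-mono (λ u → sum-mono (arc≤ u)) ⟩
    sum (λ u → sum λ v → w u v + w v u)       ≡⟨ sum-zip {g = λ u → sum (w u)} (λ u → ∑-distrib-+ (w u) (λ v → w v u)) ⟩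
    s + sum (λ u → sum λ v → w v u)           ≡⟨ cong (_+_ s) (∑-comm (λ u v → w v u)) ⟩
    s + s                                     ∎

  e≤ : edgeCount G ≤ degree G x * sum outside
  e≤ = begin
    edgeCount G                  ≤⟨ ≮⇒≥ (λ lt → <-irrefl refl (≤-trans (+-mono-<-≤ lt (<⇒≤ lt)) 2e≤)) ⟩
    s                            ≡⟨ sum-cong-≗ (λ u → sum-*ˡ (outside u) (λ v → bit (adj G u v))) ⟩
    sum (λ u → outside u * degree G u) ≤⟨ sum-mono (λ u → *-monoʳ-≤ (outside u) (max u)) ⟩
    sum (λ u → outside u * degree G x) ≡⟨ sum-cong-≗ (λ u → *-comm (outside u) (degree G x)) ⟩
    sum (λ u → degree G x * outside u) ≡⟨ sum-*ˡ (degree G x) outside ⟩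
    degree G x * sum outside     ∎

-- Deleted edges, switching, and extending a switching by one vertex.

edgeCount-∖ : ∀ {n} (G F : Graph n) → F ⊆ᴱ G →
              edgeCount G ≡ edgeCount (G ∖ F) + edgeCount F
edgeCount-∖ G F F⊆G = sum-zip λ u → sum-zip λ v →
  lem (toℕ u <ᵇ toℕ v) (adj G u v) (adj F u v) (F⊆G u v)
  where
  lem : ∀ a g f → (T f → T g) → bit (a ∧ g) ≡ bit (a ∧ (g ∧ not f)) + bit (a ∧ f)
  lem false g     f     h = refl
  lem true  true  true  h = refl
  lem true  true  false h = refl
  lem true  false false h = refl
  lem true  false true  h = ⊥-elim (h _)

-- The value true stands for the sign -; values at non-edges are junk.
record Signs (n : ℕ) : Set where
  field
    neg     : Fin n → Fin n → Bool
    neg-sym : ∀ u v → neg u v ≡ neg v u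

open Signs public

infixl 6 _-ˢ_
_-ˢ_ : ∀ {n} → Signs (suc n) → Fin (suc n) → Signs n
s -ˢ i = record
  { neg     = λ u v → neg s (punchIn i u) (punchIn i v)
  ; neg-sym = λ u v → neg-sym s (punchIn i u) (punchIn i v)
  }

-- The edges that are negative after switching at X.
frustrated : ∀ {n} → Graph n → Signs n → (Fin n → Bool) → Graph n
frustrated G s X = record
  { adj        = λ u v → adj G u v ∧ (neg s u v xor (X u xor X v))
  ; adj-sym    = λ u v → cong₂ _∧_ (adj-sym G u v)
      (cong₂ _xor_ (neg-sym s u v) (xor-comm (X u) (X v)))
  ; adj-irrefl = λ v → cong (_∧ (neg s v v xor (X v xor X v))) (adj-irrefl G v)
  }

frustrated-cong : ∀ {n} (G H : Graph n) → G ≈ H → ∀ s X → frustrated G s X ≈ frustrated H s X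
frustrated-cong G H eq s X u v = cong (_∧ (neg s u v xor (X u xor X v))) (eq u v)

≤half : ∀ {a b d} → a + b ≡ d → a ≤ ⌊ d /2⌋ ⊎ b ≤ ⌊ d /2⌋
≤half {a} {b} refl with ≤-total a b
... | inj₁ a≤b = inj₁ (subst (_≤ ⌊ a + b /2⌋) (sym (n≡⌊n+n/2⌋ a)) (⌊n/2⌋-mono (+-monoʳ-≤ a a≤b)))
... | inj₂ b≤a = inj₂ (subst (_≤ ⌊ a + b /2⌋) (sym (n≡⌊n+n/2⌋ b)) (⌊n/2⌋-mono (+-monoˡ-≤ b b≤a)))

-- The two choices for the side of i frustrate complementary sets of edges at i.
extend : ∀ {n} (G : Graph (suc n)) (s : Signs (suc n)) i (X : Fin n → Bool) → ∃ λ Y →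
         edgeCount (frustrated G s Y) ≤
         ⌊ degree G i /2⌋ + edgeCount (frustrated (G -ᵛ i) (s -ˢ i) X)
extend {n} G s i X with ≤half {degree (F false) i} {degree (F true) i} complementary
  where
  F : Bool → Graph (suc n)
  F b = frustrated G s (insertAt X i b)

  complementary : degree (F false) i + degree (F true) i ≡ degree G i
  complementary = begin
    degree (F false) i + degree (F true) i ≡⟨ cong₂ _+_ (degree-remove (F false) i) (degree-remove (F true) i) ⟩
    sum (at false) + sum (at true)         ≡⟨ sum-zip {g = at false} {h = at true} pointwise ⟨
    sum (λ u → bit (adj G i (punchIn i u))) ≡⟨ degree-remove G i ⟨
    degree G i                             ∎
    where
    open ≡-Reasoning
    at : Bool → Fin n → ℕ
    at b u = bit (adj (F b) i (punchIn i u))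

    lem : ∀ g a x → bit g ≡ bit (g ∧ (a xor (false xor x))) + bit (g ∧ (a xor (true xor x)))
    lem false a x = refl
    lem true true  true  = refl
    lem true true  false = refl
    lem true false true  = refl
    lem true false false = refl

    pointwise : ∀ u → bit (adj G i (punchIn i u)) ≡ at false u + at true u
    pointwise u rewrite insertAt-lookup X i false | insertAt-lookup X i true
      | insertAt-punchIn X i false u | insertAt-punchIn X i true u =
      lem (adj G i (punchIn i u)) (neg s i (punchIn i u)) (X u)
... | small = pick small
  where
  F : Bool → Graph (suc n)
  F b = frustrated G s (insertAt X i b)

  bound : ∀ b → degree (F b) i ≤ ⌊ degree G i /2⌋ → edgeCount (F b) ≤
          ⌊ degree G i /2⌋ + edgeCount (frustrated (G -ᵛ i) (s -ˢ i) X)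
  bound b le = begin
    edgeCount (F b)                     ≡⟨ edgeCount-remove (F b) i ⟩
    degree (F b) i + edgeCount (F b -ᵛ i)
      ≡⟨ cong (_+_ (degree (F b) i)) (edgeCount-cong (F b -ᵛ i) (frustrated (G -ᵛ i) (s -ˢ i) X) λ u v →
           cong₂ (λ x y → adj G (punchIn i u) (punchIn i v) ∧ (neg s (punchIn i u) (punchIn i v) xor (x xor y)))
             (insertAt-punchIn X i b u) (insertAt-punchIn X i b v)) ⟩
    degree (F b) i + edgeCount (frustrated (G -ᵛ i) (s -ˢ i) X) ≤⟨ +-monoˡ-≤ _ le ⟩
    ⌊ degree G i /2⌋ + edgeCount (frustrated (G -ᵛ i) (s -ˢ i) X) ∎
    where open ≤-Reasoning

  pick : degree (F false) i ≤ ⌊ degree G i /2⌋ ⊎ degree (F true) i ≤ ⌊ degree G i /2⌋ → _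
  pick (inj₁ le) = insertAt X i false , bound false le
  pick (inj₂ le) = insertAt X i true , bound true le

-- Complete split graphs and the removal of a clique vertex.

complete-adj : ∀ {n} {u v : Fin n} → u ≢ v → adj (complete n) u v ≡ true
complete-adj {u = u} {v} u≢v with u ≟ v
... | yes u≡v = contradiction u≡v u≢v
... | no _    = refl

complete-punchIn : ∀ {n} (i : Fin (suc n)) u v →
                   adj (complete (suc n)) (punchIn i u) (punchIn i v) ≡ adj (complete n) u v
complete-punchIn {n} i u v = lem (u ≟ v)
  where
  lem : Dec (u ≡ v) → _
  lem (yes refl) = trans (adj-irrefl (complete (suc n)) (punchIn i u)) (sym (adj-irrefl (complete n) u))
  lem (no u≢v)   = trans (complete-adj (u≢v ∘ punchIn-injective i u v)) (sym (complete-adj u≢v))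

splitAt-punchIn : ∀ n {m} (i : Fin (suc n)) (u : Fin (n + m)) →
                  splitAt (suc n) (punchIn (i ↑ˡ m) u) ≡ map₁ (punchIn i) (splitAt n u)
splitAt-punchIn n       zero    u    = refl
splitAt-punchIn (suc n) (suc i) zero = refl
splitAt-punchIn (suc n) (suc i) (suc u) rewrite splitAt-punchIn n i u with splitAt n u
... | inj₁ _ = refl
... | inj₂ _ = refl

S-remove : ∀ m n (i : Fin (suc n)) → S m (suc n) -ᵛ (i ↑ˡ m) ≈ S m n
S-remove m n i u v = trans
  (cong₂ (joinAdj (complete (suc n)) (edgeless m)) (splitAt-punchIn n i u) (splitAt-punchIn n i v))
  (lem (splitAt n u) (splitAt n v))
  where
  lem : ∀ x y → joinAdj (complete (suc n)) (edgeless m) (map₁ (punchIn i) x) (map₁ (punchIn i) y)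
              ≡ joinAdj (complete n) (edgeless m) x y
  lem (inj₁ u) (inj₁ v) = complete-punchIn i u v
  lem (inj₁ _) (inj₂ _) = refl
  lem (inj₂ _) (inj₁ _) = refl
  lem (inj₂ _) (inj₂ _) = refl

S-degree : ∀ m n (i : Fin (suc n)) → degree (S m (suc n)) (i ↑ˡ m) ≡ n + m
S-degree m n i = begin
  degree (S m (suc n)) (i ↑ˡ m)  ≡⟨ degree-remove (S m (suc n)) (i ↑ˡ m) ⟩
  sum (λ u → bit (adj (S m (suc n)) (i ↑ˡ m) (punchIn (i ↑ˡ m) u)))
    ≡⟨ sum-cong-≗ (λ u → cong bit (trans
         (cong₂ (joinAdj (complete (suc n)) (edgeless m)) (splitAt-↑ˡ (suc n) i m) (splitAt-punchIn n i u))
         (lem (splitAt n u)))) ⟩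
  sum {n + m} (λ _ → 1)          ≡⟨ sum-const (n + m) 1 ⟩
  (n + m) * 1                    ≡⟨ *-identityʳ (n + m) ⟩
  n + m                          ∎
  where
  open ≡-Reasoning
  lem : ∀ x → joinAdj (complete (suc n)) (edgeless m) (inj₁ i) (map₁ (punchIn i) x) ≡ true
  lem (inj₁ a) = complete-adj (punchInᵢ≢i i a ∘ sym)
  lem (inj₂ _) = refl

-- A clique vertex has degree `n + m`; for `m = 3` the half of it is the increment in the recursion
-- for the claimed maximum.
extend-S : ∀ m n (s : Signs (suc n + m)) (i : Fin (suc n)) X → ∃ λ Y →
           edgeCount (frustrated (S m (suc n)) s Y) ≤
           ⌊ n + m /2⌋ + edgeCount (frustrated (S m n) (s -ˢ (i ↑ˡ m)) X)
extend-S m n s i X with extend (S m (suc n)) s (i ↑ˡ m) X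
... | Y , le = Y , subst₂ (λ d e → edgeCount (frustrated (S m (suc n)) s Y) ≤ ⌊ d /2⌋ + e)
  (S-degree m n i) (edgeCount-cong (frustrated (S m (suc n) -ᵛ (i ↑ˡ m)) s′ X) (frustrated (S m n) s′ X)
    (frustrated-cong (S m (suc n) -ᵛ (i ↑ˡ m)) (S m n) (S-remove m n i) s′ X)) le
  where
  s′ : Signs (n + m)
  s′ = s -ˢ (i ↑ˡ m)

-- The case n = 5: a finite search.

allVec? : ∀ {n} {P : Vec Bool n → Set} → Decidable P → Dec (∀ x → P x)
allVec? {zero}  P? = map′ (λ { p [] → p }) (λ f → f []) (P? [])
allVec? {suc n} P? = map′
  (λ { (p , q) (true ∷ x) → p x ; (p , q) (false ∷ x) → q x })
  (λ f → f ∘ (true ∷_) , f ∘ (false ∷_))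
  (allVec? (P? ∘ (true ∷_)) ×-dec allVec? (P? ∘ (false ∷_)))

-- The number of edges of a star that are negative after switching: the first vector holds the
-- signs, the second the sides of the leaves, and `y` is the side of the centre.
starCost : ∀ {n} → Vec Bool n → Vec Bool n → Bool → ℕ
starCost []       []       y = 0
starCost (t ∷ ts) (x ∷ xs) y = bit (t xor (y xor x)) + starCost ts xs y

-- Row rᵢ holds the signs of the edges from clique vertex i to the later ones.
cliqueCost : Vec Bool 4 → Vec Bool 3 → Vec Bool 2 → Vec Bool 1 → Vec Bool 5 → ℕ
cliqueCost r₀ r₁ r₂ r₃ (x₀ ∷ x₁ ∷ x₂ ∷ x₃ ∷ x₄ ∷ []) =
  starCost r₀ (x₁ ∷ x₂ ∷ x₃ ∷ x₄ ∷ []) x₀ + (starCost r₁ (x₂ ∷ x₃ ∷ x₄ ∷ []) x₁ +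
  (starCost r₂ (x₃ ∷ x₄ ∷ []) x₂ + (starCost r₃ (x₄ ∷ []) x₃ + 0)))

-- Switching at X and at its complement agree, so vertex 0 may be kept on side false.
normalisedCost : Vec Bool 3 → Vec Bool 2 → Vec Bool 1 → Vec Bool 4 → ℕ
normalisedCost r₁ r₂ r₃ x = cliqueCost (replicate 4 true) r₁ r₂ r₃ (false ∷ x)

-- The three vertices outside the clique are pairwise non-adjacent, so each picks its cheaper side
-- independently. The two sides frustrate complementary sets of its five edges. The leading `true`
-- is the negative edge to vertex 0, the leading `false` the side of vertex 0.
minStar : Vec Bool 4 → Vec Bool 4 → ℕ
minStar t x = starCost (true ∷ t) (false ∷ x) false ⊓ starCost (true ∷ t) (false ∷ x) true

-- The two exhaustive checks are abstract: unfolding them on open terms does not end.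
abstract
  minStar≤2 : ∀ t x → minStar t x ≤ 2
  minStar≤2 = from-yes (allVec? λ t → allVec? λ x → minStar t x ≤? 2)

AllTrue : ∀ {n} → Vec Bool n → Set
AllTrue {n} x = x ≡ replicate n true

allTrue? : ∀ {n} (x : Vec Bool n) → Dec (AllTrue x)
allTrue? x = ≡-dec _≟ᵇ_ x _

abstract
  -- Since a vertex outside the clique costs at most 2, a branch is closed
  -- as soon as the part of the cost that is already fixed is small enough.
  search : ∀ r₁ r₂ r₃ →
    (∃ λ x → normalisedCost r₁ r₂ r₃ x ≤ 2) ⊎ (∀ t₁ →
    (∃ λ x → minStar t₁ x + normalisedCost r₁ r₂ r₃ x ≤ 4) ⊎ (∀ t₂ →
    (∃ λ x → minStar t₂ x + (minStar t₁ x + normalisedCost r₁ r₂ r₃ x) ≤ 6) ⊎ (∀ t₃ →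
    (∃ λ x → minStar t₃ x + (minStar t₂ x + (minStar t₁ x + normalisedCost r₁ r₂ r₃ x)) ≤ 8) ⊎
    ((AllTrue r₁ × AllTrue r₂ × AllTrue r₃) × AllTrue t₁ × AllTrue t₂ × AllTrue t₃))))
  search = from-yes (allVec? λ r₁ → allVec? λ r₂ → allVec? λ r₃ →
    anySubset? (λ x → normalisedCost r₁ r₂ r₃ x ≤? 2) ⊎-dec (allVec? λ t₁ →
    anySubset? (λ x → minStar t₁ x + normalisedCost r₁ r₂ r₃ x ≤? 4) ⊎-dec (allVec? λ t₂ →
    anySubset? (λ x → minStar t₂ x + (minStar t₁ x + normalisedCost r₁ r₂ r₃ x) ≤? 6) ⊎-dec (allVec? λ t₃ →
    anySubset? (λ x → minStar t₃ x + (minStar t₂ x + (minStar t₁ x + normalisedCost r₁ r₂ r₃ x)) ≤? 8) ⊎-dec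
    ((allTrue? r₁ ×-dec allTrue? r₂ ×-dec allTrue? r₃) ×-dec allTrue? t₁ ×-dec allTrue? t₂ ×-dec allTrue? t₃)))))

-- Vertex 0 will be a clique vertex, adjacent to all others, so switching always achieves this form.
-- On such a graph the only normalised signs in the switching class of the all-negative signature
-- are all negative.
Normalised : ∀ {n} → Signs (suc n) → Set
Normalised s = ∀ v → neg s zero (suc v) ≡ true

AllNegativeOn : ∀ {n} → Graph n → Signs n → Set
AllNegativeOn G s = ∀ u v → Adj G u v → neg s u v ≡ true

minStar-attained : ∀ t x → ∃ λ y → starCost (true ∷ t) (false ∷ x) y ≡ minStar t x
minStar-attained t x with ⊓-sel (starCost (true ∷ t) (false ∷ x) false) (starCost (true ∷ t) (false ∷ x) true)
... | inj₁ eq = false , sym eq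
... | inj₂ eq = true , sym eq

tabulate-true : ∀ {n} (f : Fin n → Bool) → AllTrue (tabulate f) → ∀ i → f i ≡ true
tabulate-true f eq zero    = ∷-injectiveˡ eq
tabulate-true f eq (suc i) = tabulate-true (f ∘ suc) (∷-injectiveʳ eq) i

-- Each threshold in `search`, plus 2 for every outer vertex still to come, is 8, one less than the
-- maximum 9 for n = 5. A branch closed early is completed by `minStar≤2`.
classify : ∀ r₁ r₂ r₃ t₁ t₂ t₃ →
  (∃ λ x → minStar t₃ x + (minStar t₂ x + (minStar t₁ x + normalisedCost r₁ r₂ r₃ x)) ≤ 8) ⊎
  ((AllTrue r₁ × AllTrue r₂ × AllTrue r₃) × AllTrue t₁ × AllTrue t₂ × AllTrue t₃)
classify r₁ r₂ r₃ t₁ t₂ t₃ with search r₁ r₂ r₃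
... | inj₁ (x , le) = inj₁ (x ,
  +-mono-≤ (minStar≤2 t₃ x) (+-mono-≤ (minStar≤2 t₂ x) (+-mono-≤ (minStar≤2 t₁ x) le)))
... | inj₂ search₁ with search₁ t₁
... | inj₁ (x , le) = inj₁ (x , +-mono-≤ (minStar≤2 t₃ x) (+-mono-≤ (minStar≤2 t₂ x) le))
... | inj₂ search₂ with search₂ t₂
... | inj₁ (x , le) = inj₁ (x , +-mono-≤ (minStar≤2 t₃ x) le)
... | inj₂ search₃ = search₃ t₃

module Base (s : Signs 8) (norm : Normalised s) where

  r₀ : Vec Bool 4
  r₀ = tabulate λ k → neg s 0F (suc (k ↑ˡ 3))
  r₁ : Vec Bool 3
  r₁ = neg s 1F 2F ∷ neg s 1F 3F ∷ neg s 1F 4F ∷ []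
  r₂ : Vec Bool 2
  r₂ = neg s 2F 3F ∷ neg s 2F 4F ∷ []
  r₃ : Vec Bool 1
  r₃ = neg s 3F 4F ∷ []

  t : Fin 8 → Vec Bool 4
  t v = tabulate λ k → neg s v (suc (k ↑ˡ 3))

  cost : Vec Bool 4 → ℕ
  cost x = minStar (t 7F) x + (minStar (t 6F) x + (minStar (t 5F) x + normalisedCost r₁ r₂ r₃ x))

  sides : Vec Bool 4 → Bool → Bool → Bool → Fin 8 → Bool
  sides (x₁ ∷ x₂ ∷ x₃ ∷ x₄ ∷ []) y₅ y₆ y₇ =
    lookup (false ∷ x₁ ∷ x₂ ∷ x₃ ∷ x₄ ∷ y₅ ∷ y₆ ∷ y₇ ∷ [])

  edgeCount-frustrated : ∀ x y₅ y₆ y₇ →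
    edgeCount (frustrated (S 3 5) s (sides x y₅ y₆ y₇)) ≡
    starCost (true ∷ t 7F) (false ∷ x) y₇ + (starCost (true ∷ t 6F) (false ∷ x) y₆ +
    (starCost (true ∷ t 5F) (false ∷ x) y₅ + normalisedCost r₁ r₂ r₃ x))
  edgeCount-frustrated x@(x₁ ∷ x₂ ∷ x₃ ∷ x₄ ∷ []) y₅ y₆ y₇ = begin
    edgeCount F
      ≡⟨ edgeCount-remove F 7F ⟩
    degree F 7F + edgeCount (F -ᵛ 7F)
      ≡⟨ cong (_+_ (degree F 7F)) (edgeCount-remove (F -ᵛ 7F) 6F) ⟩
    degree F 7F + (degree (F -ᵛ 7F) 6F + edgeCount (F -ᵛ 7F -ᵛ 6F))
      ≡⟨ cong (λ e → degree F 7F + (degree (F -ᵛ 7F) 6F + e)) (edgeCount-remove (F -ᵛ 7F -ᵛ 6F) 5F) ⟩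
    -- With concrete sides, the three degrees and the edge count of the remaining clique evaluate to
    -- `starCost` and `cliqueCost`; it remains to use that the edges at vertex 0 are negative.
    stars (neg s 7F 0F) (neg s 6F 0F) (neg s 5F 0F) r₀
      ≡⟨ cong₂ (λ a b → stars a b (neg s 5F 0F) r₀) (to-0 6F) (to-0 5F) ⟩
    stars true true (neg s 5F 0F) r₀
      ≡⟨ cong₂ (stars true true) (to-0 4F)
           (tabulate-cong λ k → norm (k ↑ˡ 3)) ⟩
    stars true true true (replicate 4 true) ∎
    where
    open ≡-Reasoning
    F : Graph 8
    F = frustrated (S 3 5) s (sides x y₅ y₆ y₇)

    stars : Bool → Bool → Bool → Vec Bool 4 → ℕ
    stars a₇ a₆ a₅ r₀ =
      starCost (a₇ ∷ t 7F) (false ∷ x) y₇ + (starCost (a₆ ∷ t 6F) (false ∷ x) y₆ +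
      (starCost (a₅ ∷ t 5F) (false ∷ x) y₅ + cliqueCost r₀ r₁ r₂ r₃ (false ∷ x)))

    to-0 : ∀ v → neg s (suc v) 0F ≡ true
    to-0 v = trans (neg-sym s (suc v) 0F) (norm v)

  realise : ∀ x → ∃ λ X → edgeCount (frustrated (S 3 5) s X) ≡ cost x
  realise x with minStar-attained (t 5F) x | minStar-attained (t 6F) x | minStar-attained (t 7F) x
  ... | y₅ , eq₅ | y₆ , eq₆ | y₇ , eq₇ = sides x y₅ y₆ y₇ ,
    trans (edgeCount-frustrated x y₅ y₆ y₇)
      (cong₂ _+_ eq₇ (cong₂ _+_ eq₆ (cong (_+ normalisedCost r₁ r₂ r₃ x) eq₅)))

  small : ∀ x → cost x ≤ 8 → ∃ λ X → edgeCount (frustrated (S 3 5) s X) < 9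
  small x le with realise x
  ... | X , eq = X , s≤s (≤-trans (≤-reflexive eq) le)

  negative-outer : ∀ {v} → AllTrue (t v) → ∀ k → neg s (suc (k ↑ˡ 3)) v ≡ true
  negative-outer {v} p k = trans (neg-sym s (suc (k ↑ˡ 3)) v)
    (tabulate-true (λ k → neg s v (suc (k ↑ˡ 3))) p k)

  negative-upper : (AllTrue r₁ × AllTrue r₂ × AllTrue r₃) × AllTrue (t 5F) × AllTrue (t 6F) × AllTrue (t 7F) →
                   ∀ u v → T (toℕ u <ᵇ toℕ v) → Adj (S 3 5) u v → neg s u v ≡ true
  negative-upper ((p₁ , p₂ , p₃) , p₅ , p₆ , p₇) = upper
    where
    upper : ∀ u v → T (toℕ u <ᵇ toℕ v) → Adj (S 3 5) u v → neg s u v ≡ true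
    -- The pairs not listed are out of order or consist of two outer vertices, so one of the two
    -- hypotheses is empty.
    upper 0F (suc v) _ _ = norm v
    upper 1F 2F _ _ = ∷-injectiveˡ p₁
    upper 1F 3F _ _ = ∷-injectiveˡ (∷-injectiveʳ p₁)
    upper 1F 4F _ _ = ∷-injectiveˡ (∷-injectiveʳ (∷-injectiveʳ p₁))
    upper 2F 3F _ _ = ∷-injectiveˡ p₂
    upper 2F 4F _ _ = ∷-injectiveˡ (∷-injectiveʳ p₂)
    upper 3F 4F _ _ = ∷-injectiveˡ p₃
    upper 1F 5F _ _ = negative-outer p₅ 0F
    upper 2F 5F _ _ = negative-outer p₅ 1F
    upper 3F 5F _ _ = negative-outer p₅ 2F
    upper 4F 5F _ _ = negative-outer p₅ 3F
    upper 1F 6F _ _ = negative-outer p₆ 0F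
    upper 2F 6F _ _ = negative-outer p₆ 1F
    upper 3F 6F _ _ = negative-outer p₆ 2F
    upper 4F 6F _ _ = negative-outer p₆ 3F
    upper 1F 7F _ _ = negative-outer p₇ 0F
    upper 2F 7F _ _ = negative-outer p₇ 1F
    upper 3F 7F _ _ = negative-outer p₇ 2F
    upper 4F 7F _ _ = negative-outer p₇ 3F

  negative : (AllTrue r₁ × AllTrue r₂ × AllTrue r₃) × AllTrue (t 5F) × AllTrue (t 6F) × AllTrue (t 7F) →
             AllNegativeOn (S 3 5) s
  negative p u v e with <-cmp (toℕ u) (toℕ v)
  ... | tri< u<v _ _ = negative-upper p u v (<⇒<ᵇ u<v) e
  ... | tri> _ _ v<u = trans (neg-sym s u v)
    (negative-upper p v u (<⇒<ᵇ v<u) (subst T (adj-sym (S 3 5) u v) e))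
  ... | tri≈ _ u≡v _ with refl ← toℕ-injective u≡v = ⊥-elim (subst T (adj-irrefl (S 3 5) u) e)

  base : (∃ λ X → edgeCount (frustrated (S 3 5) s X) < 9) ⊎ AllNegativeOn (S 3 5) s
  base = map-⊎ (uncurry small) negative (classify r₁ r₂ r₃ (t 5F) (t 6F) (t 7F))

-- Induction on the size of the clique.

-- maxFrustration j is the frustration index of -S_n^3 for n = 5 + j.
maxFrustration : ℕ → ℕ
maxFrustration zero    = 9
maxFrustration (suc j) = ⌊ 5 + j + 3 /2⌋ + maxFrustration j

NegativeOff : ∀ {n} → Graph n → Signs n → Fin n → Set
NegativeOff G s i = ∀ u v → i ≢ u → i ≢ v → Adj G u v → neg s u v ≡ true

-- An edge misses one of any three vertices.
negativeOff-three : ∀ {n} (G : Graph n) s {i j k} → i ≢ j → i ≢ k → j ≢ k →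
                 NegativeOff G s i → NegativeOff G s j → NegativeOff G s k → AllNegativeOn G s
negativeOff-three G s {i} {j} {k} i≢j i≢k j≢k oi oj ok u v e with i ≟ u | i ≟ v | j ≟ u | j ≟ v
... | no i≢u   | no i≢v   | _        | _        = oi u v i≢u i≢v e
... | yes refl | _        | _        | no j≢v   = oj i v (i≢j ∘ sym) j≢v e
... | yes refl | _        | _        | yes refl = ok i j (i≢k ∘ sym) (j≢k ∘ sym) e
... | no i≢u   | yes refl | no j≢u   | _        = oj u i j≢u (i≢j ∘ sym) e
... | no i≢u   | yes refl | yes refl | _        = ok j i (j≢k ∘ sym) (i≢k ∘ sym) e

-- Either a strict improvement on the smaller graph survives the extension by the removed vertex, or
-- the signs of the smaller graph are read back through `punchOut`.
small-or-negativeOff : ∀ m n k (s : Signs (suc n + m)) (i : Fin (suc n)) →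
  (∃ λ X → edgeCount (frustrated (S m n) (s -ˢ (i ↑ˡ m)) X) < k) ⊎ AllNegativeOn (S m n) (s -ˢ (i ↑ˡ m)) →
  (∃ λ Y → edgeCount (frustrated (S m (suc n)) s Y) < ⌊ n + m /2⌋ + k) ⊎ NegativeOff (S m (suc n)) s (i ↑ˡ m)
small-or-negativeOff m n k s i (inj₁ (X , lt)) =
  inj₁ (map₂ (λ le → ≤-<-trans le (+-monoʳ-< ⌊ n + m /2⌋ lt)) (extend-S m n s i X))
small-or-negativeOff m n k s i (inj₂ all) = inj₂ λ u v i≢u i≢v →
  subst₂ (λ u v → Adj (S m (suc n)) u v → neg s u v ≡ true) (punchIn-punchOut i≢u) (punchIn-punchOut i≢v)
    (all (punchOut i≢u) (punchOut i≢v) ∘ subst T (S-remove m n i (punchOut i≢u) (punchOut i≢v)))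

three-removals : ∀ {n} (G : Graph n) s {i j k} {A : Set} → i ≢ j → i ≢ k → j ≢ k →
  A ⊎ NegativeOff G s i → A ⊎ NegativeOff G s j → A ⊎ NegativeOff G s k → A ⊎ AllNegativeOn G s
three-removals G s _ _ _ (inj₁ a) _ _ = inj₁ a
three-removals G s _ _ _ (inj₂ _) (inj₁ a) _ = inj₁ a
three-removals G s _ _ _ (inj₂ _) (inj₂ _) (inj₁ a) = inj₁ a
three-removals G s i≢j i≢k j≢k (inj₂ oi) (inj₂ oj) (inj₂ ok) =
  inj₂ (negativeOff-three G s i≢j i≢k j≢k oi oj ok)

-- The strict inequality is what yields uniqueness: signs that reach the maximum must fall under the
-- second alternative.
small-or-allNegative : ∀ j (s : Signs (5 + j + 3)) → Normalised s →
  (∃ λ X → edgeCount (frustrated (S 3 (5 + j)) s X) < maxFrustration j) ⊎ AllNegativeOn (S 3 (5 + j)) s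
small-or-allNegative zero    s norm = Base.base s norm
small-or-allNegative (suc j) s norm =
  -- Vertex 0 is kept, so its edges stay negative and the smaller signs are again normalised.
  three-removals (S 3 (6 + j)) s {1F} {2F} {3F} (λ ()) (λ ()) (λ ()) (without 0F) (without 1F) (without 2F)
  where
  without : (i : Fin (5 + j)) →
    (∃ λ Y → edgeCount (frustrated (S 3 (6 + j)) s Y) < maxFrustration (suc j)) ⊎
    NegativeOff (S 3 (6 + j)) s (suc i ↑ˡ 3)
  without i = small-or-negativeOff 3 (5 + j) (maxFrustration j) s (suc i)
    (small-or-allNegative j (s -ˢ (suc i ↑ˡ 3)) (λ v → norm (punchIn (i ↑ˡ 3) v)))

-- Frustrated sets of the all-negative signs.

allNegativeSigns : ∀ n → Signs n
allNegativeSigns n = record { neg = λ _ _ → true ; neg-sym = λ _ _ → refl }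

allNegativeSigns-extend : ∀ m n k →
  (∃ λ X → edgeCount (frustrated (S m n) (allNegativeSigns (n + m)) X) ≤ k) →
  ∃ λ Y → edgeCount (frustrated (S m (suc n)) (allNegativeSigns (suc n + m)) Y) ≤ ⌊ n + m /2⌋ + k
allNegativeSigns-extend m n k (X , le) =
  map₂ (λ le′ → ≤-trans le′ (+-monoʳ-≤ ⌊ n + m /2⌋ le)) (extend-S m n (allNegativeSigns (suc n + m)) zero X)

-- For n = 5 the optimal bipartition separates one clique vertex, together
-- with the three independent vertices, from the other four.
allNegativeSigns-frustrated : ∀ j → ∃ λ X →
  edgeCount (frustrated (S 3 (5 + j)) (allNegativeSigns (5 + j + 3)) X) ≤ maxFrustration j
allNegativeSigns-frustrated zero    =
  lookup (true ∷ false ∷ false ∷ false ∷ false ∷ true ∷ true ∷ true ∷ []) , ≤-refl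
allNegativeSigns-frustrated (suc j) =
  allNegativeSigns-extend 3 (5 + j) (maxFrustration j) (allNegativeSigns-frustrated j)

frustrated-allNegative : ∀ {n} (G : Graph n) s → AllNegativeOn G s → ∀ X →
                         frustrated G s X ≈ frustrated G (allNegativeSigns n) X
frustrated-allNegative G s all X u v with adj G u v in uv
... | false = refl
... | true  = cong (_xor (X u xor X v)) (all u v (subst T (sym uv) _))

-- Normalisation, and signatures as Boolean signs.

-- Switching moves exactly the ends of positive edges at vertex 0 to the other side.
sidesOf0 : ∀ {n} → Signs (suc n) → Fin (suc n) → Bool
sidesOf0 s zero    = false
sidesOf0 s (suc v) = not (neg s zero (suc v))

switchSigns : ∀ {n} → (Fin n → Bool) → Signs n → Signs n
switchSigns X s = record
  { neg     = λ u v → neg s u v xor (X u xor X v)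
  ; neg-sym = λ u v → cong₂ _xor_ (neg-sym s u v) (xor-comm (X u) (X v))
  }

normalise : ∀ {n} (s : Signs (suc n)) → Normalised (switchSigns (sidesOf0 s) s)
normalise s v with neg s zero (suc v)
... | true  = refl
... | false = refl

frustrated-switch : ∀ {n} (G : Graph n) X s Y →
  frustrated G (switchSigns X s) Y ≈ frustrated G s (λ v → X v xor Y v)
frustrated-switch G X s Y u v = cong (adj G u v ∧_)
  (solve 5 (λ a p q x y → (a :+ (p :+ q)) :+ (x :+ y) := a :+ ((p :+ x) :+ (q :+ y)))
    refl (neg s u v) (X u) (X v) (Y u) (Y v))
  where open xor-∧-Solver

isNegative : Sign → Bool
isNegative Sign.- = true
isNegative Sign.+ = false

toSign : Bool → Sign
toSign true  = Sign.-
toSign false = Sign.+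

toSign-isNegative : ∀ s → toSign (isNegative s) ≡ s
toSign-isNegative Sign.- = refl
toSign-isNegative Sign.+ = refl

-- A sign is only available together with a proof of adjacency. Taking the adjacency Boolean as an
-- argument allows a case split on it, with default `false` at non-edges.
isNegativeAt : (b : Bool) → (T b → Sign) → Bool
isNegativeAt true  f = isNegative (f _)
isNegativeAt false f = false

isNegativeAt-≡ : ∀ b f (e : T b) → isNegativeAt b f ≡ isNegative (f e)
isNegativeAt-≡ true f e = refl

isNegativeAt-∉ : ∀ b f → ¬ T b → isNegativeAt b f ≡ false
isNegativeAt-∉ true  f ¬e = contradiction _ ¬e
isNegativeAt-∉ false f ¬e = refl

signs : ∀ {n} {G : Graph n} → Signature G → Signs n
signs {n} {G} σ = record { neg = λ u v → isNegativeAt (adj G u v) (sign σ u v) ; neg-sym = symmetric }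
  where
  symmetric : ∀ u v → isNegativeAt (adj G u v) (sign σ u v) ≡ isNegativeAt (adj G v u) (sign σ v u)
  symmetric u v with T? (adj G u v)
  ... | yes e = trans (isNegativeAt-≡ _ (sign σ u v) e)
    (trans (cong isNegative (sign-sym σ u v e e′)) (sym (isNegativeAt-≡ _ (sign σ v u) e′)))
    where
    e′ : Adj G v u
    e′ = subst T (adj-sym G u v) e
  ... | no ¬e = trans (isNegativeAt-∉ _ (sign σ u v) ¬e)
    (sym (isNegativeAt-∉ _ (sign σ v u) (¬e ∘ subst T (adj-sym G v u))))

neg-signs : ∀ {n} {G : Graph n} (σ : Signature G) u v e → neg (signs σ) u v ≡ isNegative (sign σ u v e)
neg-signs {G = G} σ u v = isNegativeAt-≡ (adj G u v) (sign σ u v)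

-- Balance: frustrated sets and triangles.

frustrated-⊆ : ∀ {n} (G : Graph n) s X → frustrated G s X ⊆ᴱ G
frustrated-⊆ G s X u v = proj₁ ∘ Equivalence.to T-∧

-- An edge that survives is negative exactly when its ends lie on different sides of `X`. Hence the
-- sign of a walk depends only on the sides of its two ends, and every closed walk is positive.
frustrated-balanced : ∀ {n} {G : Graph n} (σ : Signature G) X →
                      Balanced (deleteEdges σ (frustrated G (signs σ) X))
frustrated-balanced {n} {G} σ X {v} w _ = trans (telescope w) (xor-self (X v))
  where
  F : Graph n
  F = frustrated G (signs σ) X

  xor-self : ∀ x → toSign (x xor x) ≡ Sign.+
  xor-self true  = refl
  xor-self false = refl

  unfrustrated : ∀ a b c → T (a ∧ not (a ∧ (b xor c))) → b ≡ c
  unfrustrated true true  true  _ = refl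
  unfrustrated true false false _ = refl

  compose : ∀ x y z → toSign (x xor y) Sign.* toSign (y xor z) ≡ toSign (x xor z)
  compose true  true  z = refl
  compose true  false true  = refl
  compose true  false false = refl
  compose false true  true  = refl
  compose false true  false = refl
  compose false false z = refl

  edge : ∀ {u v} (e : Adj (G ∖ F) u v) → sign (deleteEdges σ F) u v e ≡ toSign (X u xor X v)
  edge {u} {v} e = trans (sym (toSign-isNegative _)) (cong toSign
    (trans (sym (neg-signs σ u v _)) (unfrustrated (adj G u v) _ _ e)))

  telescope : ∀ {u v} (w : Walk (G ∖ F) u v) → walkSign (deleteEdges σ F) w ≡ toSign (X u xor X v)
  telescope {u} []      = sym (xor-self (X u))
  telescope {u} (_∷_ {v = v} e w) = trans (cong₂ Sign._*_ (edge e) (telescope w)) (compose (X u) (X v) _)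

-- A triangle would be a cycle with three negative edges, hence a negative cycle.
allNegative-triangleFree : ∀ {n} (G F : Graph n) → Balanced (deleteEdges (allNegative G) F) →
                           TriangleFree (G ∖ F)
allNegative-triangleFree G F bal u v w uv vw wu =
  -≢+ (bal (uv ∷ vw ∷ wu ∷ []) (s≤s (s≤s (s≤s z≤n)) ,
    (ends≢ uv ∷ (ends≢ wu ∘ sym) ∷ []) ∷ (ends≢ vw ∷ []) ∷ [] ∷ []))
  where
  -≢+ : Sign.- ≢ Sign.+
  -≢+ ()

  ends≢ : ∀ {u v} → Adj (G ∖ F) u v → u ≢ v
  ends≢ {u} e refl = subst T (adj-irrefl (G ∖ F) u) e

-- Upper bound for arbitrary signatures.

-- Removes the normalisation. If the normalised signs are all negative, the side choice given for
-- the all-negative signs is pulled back to `σ`, and the normalising switch itself witnesses the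
-- equivalence.
frustrationBound : ∀ {n} (G : Graph (suc n)) k →
  (∀ s → Normalised s → (∃ λ X → edgeCount (frustrated G s X) < k) ⊎ AllNegativeOn G s) →
  (∃ λ X → edgeCount (frustrated G (allNegativeSigns (suc n)) X) ≤ k) →
  ∀ (σ : Signature G) →
  (∃ λ X → edgeCount (frustrated G (signs σ) X) < k) ⊎
  ((∃ λ X → edgeCount (frustrated G (signs σ) X) ≤ k) × SwitchingEquivalent σ (allNegative G))
frustrationBound {n} G k bound (Y , le) σ = analyse (bound s′ (normalise s))
  where
  s s′ : Signs (suc n)
  s = signs σ
  X₀ : Fin (suc n) → Bool
  X₀ = sidesOf0 s
  s′ = switchSigns X₀ s

  _⊕X₀ : (Fin (suc n) → Bool) → Fin (suc n) → Bool
  (X ⊕X₀) v = X₀ v xor X v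

  back : ∀ X → edgeCount (frustrated G s′ X) ≡ edgeCount (frustrated G s (X ⊕X₀))
  back X = edgeCount-cong (frustrated G s′ X) (frustrated G s (X ⊕X₀)) (frustrated-switch G X₀ s X)

  flip-negative : ∀ b t → isNegative t xor b ≡ true → Sign.- ≡ (if b then opposite t else t)
  flip-negative true  Sign.+ _ = refl
  flip-negative false Sign.- _ = refl

  switched : AllNegativeOn G s′ → ∀ u v e → Sign.- ≡ sign (switch (tabulate X₀) σ) u v e
  switched all u v e rewrite lookup∘tabulate X₀ u | lookup∘tabulate X₀ v =
    flip-negative (X₀ u xor X₀ v) (sign σ u v e)
      (trans (cong (_xor (X₀ u xor X₀ v)) (sym (neg-signs σ u v e))) (all u v e))

  analyse : (∃ λ X → edgeCount (frustrated G s′ X) < k) ⊎ AllNegativeOn G s′ → _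
  analyse (inj₁ (X , lt)) = inj₁ (X ⊕X₀ , subst (_< k) (back X) lt)
  analyse (inj₂ all)      = inj₂
    ( (Y ⊕X₀ , subst (_≤ k) (trans
        (sym (edgeCount-cong (frustrated G s′ Y) (frustrated G (allNegativeSigns (suc n)) Y)
          (frustrated-allNegative G s′ all Y)))
        (back Y)) le)
    , tabulate X₀ , switched all)

frustrationBound-S : ∀ j (σ : Signature (S 3 (5 + j))) →
  (∃ λ X → edgeCount (frustrated (S 3 (5 + j)) (signs σ) X) < maxFrustration j) ⊎
  ((∃ λ X → edgeCount (frustrated (S 3 (5 + j)) (signs σ) X) ≤ maxFrustration j) ×
   SwitchingEquivalent σ (allNegative (S 3 (5 + j))))
frustrationBound-S j = frustrationBound (S 3 (5 + j)) (maxFrustration j)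
  (small-or-allNegative j) (allNegativeSigns-frustrated j)

-- Closed form of the maximum and the lower bound.

-- With n = 5 + j, `r` is 1 for odd n and 0 for even n. The induction goes in steps of two because
-- two consecutive increments are the floor and the ceiling of one half, which add up to a whole
-- number.
maxFrustration-closed : ∀ j → ∃ λ r → r ≤ 1 × (5 + j) * (5 + j) + 4 * (5 + j) ≡ 4 * maxFrustration j + 8 + r
maxFrustration-closed 0 = 1 , ≤-refl , refl
maxFrustration-closed 1 = 0 , z≤n , refl
maxFrustration-closed (suc (suc j)) with r , r≤1 , eq ← maxFrustration-closed j = r , r≤1 , (begin
  (7 + j) * (7 + j) + 4 * (7 + j)                     ≡⟨ left j ⟩
  4 * (5 + j + 3) + ((5 + j) * (5 + j) + 4 * (5 + j)) ≡⟨ cong (λ x → 4 * (5 + j + 3) + x) eq ⟩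
  4 * (5 + j + 3) + (4 * ℓ + 8 + r)                   ≡⟨ right (5 + j + 3) ℓ r ⟩
  4 * (5 + j + 3 + ℓ) + 8 + r
    ≡⟨ cong (λ m → 4 * (m + ℓ) + 8 + r) (⌊n/2⌋+⌈n/2⌉≡n (5 + j + 3)) ⟨
  4 * (⌊ 5 + j + 3 /2⌋ + ⌈ 5 + j + 3 /2⌉ + ℓ) + 8 + r
    ≡⟨ cong (λ m → 4 * m + 8 + r) (shuffle ⌊ 5 + j + 3 /2⌋ ⌈ 5 + j + 3 /2⌉ ℓ) ⟩
  4 * maxFrustration (suc (suc j)) + 8 + r            ∎)
  where
  open ≡-Reasoning
  ℓ : ℕ
  ℓ = maxFrustration j
  left : ∀ j → (7 + j) * (7 + j) + 4 * (7 + j) ≡ 4 * (5 + j + 3) + ((5 + j) * (5 + j) + 4 * (5 + j))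
  left = solve-∀
  right : ∀ m ℓ r → 4 * m + (4 * ℓ + 8 + r) ≡ 4 * (m + ℓ) + 8 + r
  right = solve-∀
  shuffle : ∀ a b c → a + b + c ≡ b + (a + c)
  shuffle = solve-∀

-- The count n(n-1)/2 + nm, doubled and rearranged to avoid division and subtraction.
edgeCount-S : ∀ m n → edgeCount (S m n) + edgeCount (S m n) + n ≡ n * n + 2 * (n * m)
edgeCount-S m zero = begin
  edgeCount (S m 0) + edgeCount (S m 0) + 0  ≡⟨ +-identityʳ _ ⟩
  edgeCount (S m 0) + edgeCount (S m 0)      ≡⟨ handshake (S m 0) ⟨
  sum {m} (λ _ → sum {m} (λ _ → 0))          ≡⟨ sum-cong-≗ {m} (λ _ → zeros m) ⟩
  sum {m} (λ _ → 0)                          ≡⟨ zeros m ⟩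
  0                                          ∎
  where
  open ≡-Reasoning
  zeros : ∀ m → sum {m} (λ _ → 0) ≡ 0
  zeros m = trans (sum-const m 0) (*-zeroʳ m)
edgeCount-S m (suc n) = begin
  edgeCount (S m (suc n)) + edgeCount (S m (suc n)) + suc n ≡⟨ cong (λ e → e + e + suc n) remove ⟩
  (n + m + e) + (n + m + e) + suc n  ≡⟨ left m n e ⟩
  (e + e + n) + (2 * n + 2 * m + 1)  ≡⟨ cong (_+ (2 * n + 2 * m + 1)) (edgeCount-S m n) ⟩
  n * n + 2 * (n * m) + (2 * n + 2 * m + 1) ≡⟨ right m n ⟩
  suc n * suc n + 2 * (suc n * m)    ∎
  where
  open ≡-Reasoning
  e : ℕ
  e = edgeCount (S m n)
  remove : edgeCount (S m (suc n)) ≡ n + m + e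
  remove = trans (edgeCount-remove (S m (suc n)) (zero {n} ↑ˡ m))
    (cong₂ _+_ (S-degree m n zero) (edgeCount-cong (S m (suc n) -ᵛ (zero {n} ↑ˡ m)) (S m n) (S-remove m n zero)))
  left : ∀ m n e → (n + m + e) + (n + m + e) + suc n ≡ (e + e + n) + (2 * n + 2 * m + 1)
  left = solve-∀
  right : ∀ m n → n * n + 2 * (n * m) + (2 * n + 2 * m + 1) ≡ suc n * suc n + 2 * (suc n * m)
  right = solve-∀

-- Mantel's theorem on n + 3 vertices, with 4e = 2n² + 10n for the e edges of the split graph, gives
-- n² + 4n - 9 ≤ 4f. By the closed form 4ℓ ≤ 4f + 1, and integrality removes the 1.
lowerBound : ∀ j (F : Graph (5 + j + 3)) → F ⊆ᴱ S 3 (5 + j) →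
             Balanced (deleteEdges (allNegative (S 3 (5 + j))) F) → maxFrustration j ≤ edgeCount F
lowerBound j F F⊆G bal with r , _ , closed ← maxFrustration-closed j =
  ≮⇒≥ λ f<ℓ → contradiction (≤-trans (*-monoʳ-≤ 4 f<ℓ) 4ℓ≤) (<⇒≱ (gap f))
  where
  n f a : ℕ
  n = 5 + j
  G : Graph (n + 3)
  G = S 3 n
  f = edgeCount F
  a = edgeCount (G ∖ F)

  open ≤-Reasoning

  gap : ∀ f → 4 * f + 1 < 4 * suc f
  gap f = subst (4 * f + 1 <_) (eq f) (m<m+n (4 * f + 1) {3} (s≤s z≤n))
    where
    eq : ∀ f → 4 * f + 1 + 3 ≡ 4 * suc f
    eq = solve-∀

  expand : ∀ n → (n * n + 4 * n) + (n + 3) * (n + 3) + 2 * n ≡ 2 * (n * n + 2 * (n * 3)) + 9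
  expand = solve-∀

  collect : ∀ a f n → 2 * ((a + f) + (a + f) + n) + 9 ≡ 4 * a + (4 * f + 9) + 2 * n
  collect = solve-∀

  regroup : ∀ x f n → x + (4 * f + 9) + 2 * n ≡ (4 * f + 9) + x + 2 * n
  regroup = solve-∀

  bound : n * n + 4 * n ≤ 4 * f + 9
  bound = +-cancelʳ-≤ ((n + 3) * (n + 3)) _ _ (+-cancelʳ-≤ (2 * n) _ _ (begin
    (n * n + 4 * n) + (n + 3) * (n + 3) + 2 * n ≡⟨ expand n ⟩
    2 * (n * n + 2 * (n * 3)) + 9               ≡⟨ cong (λ e → 2 * e + 9) (edgeCount-S 3 n) ⟨
    2 * (edgeCount G + edgeCount G + n) + 9     ≡⟨ cong (λ e → 2 * (e + e + n) + 9) (edgeCount-∖ G F F⊆G) ⟩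
    2 * ((a + f) + (a + f) + n) + 9             ≡⟨ collect a f n ⟩
    4 * a + (4 * f + 9) + 2 * n
      ≤⟨ +-monoˡ-≤ (2 * n) (+-monoˡ-≤ (4 * f + 9) (mantel (G ∖ F) (allNegative-triangleFree G F bal))) ⟩
    (n + 3) * (n + 3) + (4 * f + 9) + 2 * n     ≡⟨ regroup ((n + 3) * (n + 3)) f n ⟩
    (4 * f + 9) + (n + 3) * (n + 3) + 2 * n     ∎))

  shift : ∀ f → 4 * f + 9 ≡ 4 * f + 1 + 8
  shift = solve-∀

  4ℓ≤ : 4 * maxFrustration j ≤ 4 * f + 1
  4ℓ≤ = +-cancelʳ-≤ 8 _ _ (begin
    4 * maxFrustration j + 8     ≤⟨ m≤m+n _ r ⟩
    4 * maxFrustration j + 8 + r ≡⟨ closed ⟨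
    n * n + 4 * n                ≤⟨ bound ⟩
    4 * f + 9                    ≡⟨ shift f ⟩
    4 * f + 1 + 8                ∎)

-- The frustration index, its maximum and uniqueness.

allNegative-index : ∀ j → FrustrationIndex (allNegative (S 3 (5 + j))) (maxFrustration j)
allNegative-index j = (F , F⊆ , bal , ≤-antisym F≤ (lowerBound j F F⊆ bal)) , lowerBound j
  where
  G : Graph (5 + j + 3)
  G = S 3 (5 + j)
  opt : ∃ λ X → edgeCount (frustrated G (signs (allNegative G)) X) ≤ maxFrustration j
  opt = [ (λ (X , lt) → X , <⇒≤ lt) , proj₁ ]′ (frustrationBound-S j (allNegative G))
  F : Graph (5 + j + 3)
  F = frustrated G (signs (allNegative G)) (proj₁ opt)
  F≤ = proj₂ opt
  F⊆ = frustrated-⊆ G (signs (allNegative G)) (proj₁ opt)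
  bal : Balanced (deleteEdges (allNegative G) F)
  bal = frustrated-balanced (allNegative G) (proj₁ opt)

index≤ : ∀ {n} {G : Graph n} (σ : Signature G) {k} → FrustrationIndex σ k →
         ∀ X → k ≤ edgeCount (frustrated G (signs σ) X)
index≤ {G = G} σ (_ , min) X = min (frustrated G (signs σ) X) (frustrated-⊆ G (signs σ) X) (frustrated-balanced σ X)

max-index : ∀ j → MaxFrustrationIndex (S 3 (5 + j)) (maxFrustration j)
max-index j = (allNegative _ , allNegative-index j) , λ σ l fi →
  [ (λ (X , lt) → ≤-trans (index≤ σ fi X) (<⇒≤ lt))
  , (λ ((X , le) , _) → ≤-trans (index≤ σ fi X) le) ]′ (frustrationBound-S j σ)

-- A frustrated set with fewer than `maxFrustration j` edges would contradict the minimality in the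
-- index of `σ`.
unique-max : ∀ j (σ : Signature (S 3 (5 + j))) → FrustrationIndex σ (maxFrustration j) →
             SwitchingEquivalent σ (allNegative (S 3 (5 + j)))
unique-max j σ fi =
  [ (λ (X , lt) → contradiction (index≤ σ fi X) (<⇒≱ lt)) , proj₂ ]′ (frustrationBound-S j σ)

-- Evaluation of the floor.

splitFormula-closed : ∀ j → + maxFrustration j ≡ splitFormula (5 + j)
splitFormula-closed j with r , r≤1 , closed ← maxFrustration-closed j = sym (begin
  splitFormula (5 + j)              ≡⟨⟩
  -- Unnormalised rationals are added over the product of denominators 4 · 2 · 4 = 32, and
  -- `-[1+ 71 ]` is -9 · 8. The numerator equals 8(4ℓ + r), and 8r < 32 vanishes under the floor.
  (+ M ℤ.+ -[1+ 71 ]) ℤ./ + 32      ≡⟨ cong (λ m → (+ m ℤ.+ -[1+ 71 ]) ℤ./ + 32) M≡ ⟩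
  + (8 * r + ℓ * 32) ℤ./ + 32       ≡⟨ div-pos-is-/ℕ (+ (8 * r + ℓ * 32)) 32 ⟩
  + ((8 * r + ℓ * 32) / 32)         ≡⟨ cong +_ (+-distrib-/-∣ʳ (8 * r) (n∣m*n ℓ)) ⟩
  + (8 * r / 32 + ℓ * 32 / 32)      ≡⟨ cong₂ (λ x y → + (x + y)) (m<n⇒m/n≡0 8r<32) (m*n/n≡m ℓ 32) ⟩
  + ℓ                               ∎)
  where
  open ≡-Reasoning
  ℓ M : ℕ
  ℓ = maxFrustration j
  M = ((4 + j) * ((4 + j) * 1) * 2 + 3 * (5 + j) * 4) * 4

  8r<32 : 8 * r < 32
  8r<32 = ≤-<-trans (*-monoʳ-≤ 8 r≤1) (m≤m+n 9 23)

  expand : ∀ j → ((4 + j) * ((4 + j) * 1) * 2 + 3 * (5 + j) * 4) * 4 ≡ 8 * ((5 + j) * (5 + j) + 4 * (5 + j)) + 8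
  expand = solve-∀
  collect : ∀ ℓ r → 8 * (4 * ℓ + 8 + r) + 8 ≡ 72 + (8 * r + ℓ * 32)
  collect = solve-∀

  M≡ : M ≡ 72 + (8 * r + ℓ * 32)
  M≡ = trans (expand j) (trans (cong (λ x → 8 * x + 8) closed) (collect ℓ r))

theorem33 : ∀ (n : ℕ) → 5 ≤ n →
    AllNegativeMaximisesUniquely (S 3 n) ×
    (∃ λ l →
    MaxFrustrationIndex (S 3 n) l ×
    FrustrationIndex (allNegative (S 3 n)) l ×
    + l ≡ splitFormula n)
theorem33 (suc (suc (suc (suc (suc j))))) (s≤s (s≤s (s≤s (s≤s (s≤s z≤n))))) =
  (maxFrustration j , allNegative-index j , max-index j , unique-max j) ,
  (maxFrustration j , max-index j , allNegative-index j , splitFormula-closed j)
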